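{- Let $K$ be a token swapping instance, let $OPT(K)$ be the length of the shortest swap sequence for $K$, and let $ALG(K)$ be the length of the swap sequence returned by the cycle-based algorithm described in the context when run on $K$. Then $OPT(K) \leq ALG(K) \leq 4 \cdot OPT(K)$.
   Context: A Token Swapping instance $K = (G, T, f_1, f_2)$ consists of an undirected graph $G = (V,E)$ on $n$ vertices, a set of (distinct) tokens $T$ with $|T| = |V|$, and two one-to-one assignments $f_1, f_2 : T \to V$, called the starting and target configurations respectively. A swap along an edge $(u,v) \in E$ switches the locations of the tokens currently on $u$ and $v$. A swap sequence for $K$ is a sequence of swaps that transforms the starting configuration into the target configuration; its length is its number of swaps. When a token $t$ lies on vertex $u_1$ of a path $u_1, u_2, \dots, u_m$, bubbling $t$ along the path means performing the swaps $(u_1,u_2), (u_2,u_3), \dots, (u_{m-1},u_m)$ in this order. The algorithm. The functions $f_1, f_2$ induce a permutation $\pi$ of the vertices, which maps a vertex $v$ to the target vertex $f_2(f_1^{ -1}(v))$ of the token starting on $v$. Decompose $\pi$ into disjoint cycles $\pi = C_1 \circ \dots \circ C_k$ (every vertex lies in exactly one cycle, fixed points being cycles of length 1), where $C_i$ consists of vertices $v_{i,0}, \dots, v_{i,\ell_i - 1}$ with $f_2(f_1^{ -1}(v_{i,j})) = v_{i, j+1 \pmod{\ell_i}}$. Then: For each $i = 1, \dots, k$ (the $i$-th phase): for each $j = \ell_i - 1, \ell_i - 2, \dots, 1$ (in this order): (i) let $t_{i,j-1}$ be the token currently on $v_{i,j-1}$, let $t_{i,j}$ be the token currently on $v_{i,j}$,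 and let $p_{i,j}$ be a shortest path in $G$ between $v_{i,j-1}$ and $v_{i,j}$; (ii) bubble $t_{i,j-1}$ along $p_{i,j}$ until it reaches $v_{i,j}$; (iii) bubble $t_{i,j}$ in reverse order along $p_{i,j}$ (from its current vertex) until it reaches $v_{i,j-1}$. -}

module Defs where

open import Data.Fin using (Fin)
open import Data.Fin.Permutation using (Permutation′; _⟨$⟩ʳ_; _⟨$⟩ˡ_; _≈_; _∘ₚ_; flip; transpose)
open import Data.Fin.Properties using (_≟_)
open import Data.List using (List; []; _∷_; [_]; _++_; concatMap; dropWhile; foldl; head; last; length; reverse)
open import Data.List.Membership.Propositional using (_∈_)
open import Data.List.NonEmpty using (List⁺; _∷_; toList)
open import Data.List.Relation.Unary.All using (All)
open import Data.List.Relation.Unary.Linked using (Linked)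
open import Data.List.Relation.Unary.Unique.Propositional using (Unique)
open import Data.Maybe using (just)
open import Data.Nat using (ℕ; _≤_)
open import Data.Product using (_×_; _,_; ∃-syntax; uncurry)
open import Level using (0ℓ)
open import Relation.Binary using (Rel; Symmetric; Irreflexive)
open import Relation.Binary.PropositionalEquality using (_≡_)
open import Relation.Nullary.Decidable using (¬?)

record Graph (n : ℕ) : Set₁ where
  field
    Adj    : Rel (Fin n) 0ℓ
    sym    : Symmetric Adj
    irrefl : Irreflexive _≡_ Adj

-- Tokens, like vertices, are numbered by Fin n; a configuration σ places
-- token t on vertex σ ⟨$⟩ʳ t, and σ ⟨$⟩ˡ v is the token on vertex v.
Config : ℕ → Set
Config = Permutation′

record Instance (n : ℕ) : Set₁ where
  field
    graph : Graph n
    f₁ f₂ : Config n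
  open Graph graph public

  -- v ↦ f₂ (f₁⁻¹ v), as _∘ₚ_ composes in diagrammatic order.
  π : Permutation′ n
  π = flip f₁ ∘ₚ f₂

module _ {n : ℕ} where

  Swap : Set
  Swap = Fin n × Fin n

  swap : Config n → Swap → Config n
  swap σ (u , v) = σ ∘ₚ transpose u v

  perform : Config n → List Swap → Config n
  perform = foldl swap

  consecutive : List (Fin n) → List (Fin n × Fin n)
  consecutive []           = []
  consecutive (_ ∷ [])     = []
  consecutive (u ∷ v ∷ vs) = (u , v) ∷ consecutive (v ∷ vs)

  bubbleAlong : List (Fin n) → List Swap
  bubbleAlong = consecutive

  -- The part of a path starting at its vertex v.
  suffixFrom : Fin n → List (Fin n) → List (Fin n)
  suffixFrom v = dropWhile (λ w → ¬? (w ≟ v))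

  pathLength : List (Fin n) → ℕ
  pathLength p = length (consecutive p)

  -- One round of the inner loop, for u = v_{i,j-1}, v = v_{i,j} and a path p
  -- from u to v: the token on u is bubbled along p, then the token that was
  -- on v is bubbled back to u, from wherever the first bubbling left it.
  exchange : Config n → Fin n → List (Fin n) → List Swap
  exchange σ v p = there ++ back
    where
    tⱼ    = σ ⟨$⟩ˡ v
    there = bubbleAlong p
    back  = bubbleAlong (suffixFrom (perform σ there ⟨$⟩ʳ tⱼ) (reverse p))

  -- π sends each entry of the list to the next one, and the last to the first.
  IsCycle : Permutation′ n → List⁺ (Fin n) → Set
  IsCycle π (v ∷ vs) = Linked (λ x y → π ⟨$⟩ʳ x ≡ y) (v ∷ vs ++ [ v ])

  record IsCycleDecomposition (π : Permutation′ n) (cs : List (List⁺ (Fin n))) : Set where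
    field
      cycles   : All (IsCycle π) cs
      disjoint : Unique (concatMap toList cs)
      covers   : ∀ v → v ∈ concatMap toList cs

  -- The pairs (v_{i,j-1} , v_{i,j}) in the order in which the algorithm treats
  -- them: i increasing and, within each cycle, j decreasing from ℓᵢ - 1 to 1.
  schedule : List (List⁺ (Fin n)) → List (Fin n × Fin n)
  schedule = concatMap (λ c → reverse (consecutive (toList c)))

module _ {n : ℕ} (K : Instance n) where
  open Instance K

  record IsPath (u v : Fin n) (p : List (Fin n)) : Set where
    field
      starts   : head p ≡ just u
      ends     : last p ≡ just v
      edges    : Linked Adj p
      distinct : Unique p

  record IsShortestPath (u v : Fin n) (p : List (Fin n)) : Set where
    field
      isPath   : IsPath u v p
      shortest : ∀ {q} → IsPath u v q → pathLength p ≤ pathLength q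

  record IsSwapSequence (s : List Swap) : Set where
    field
      alongEdges    : All (uncurry Adj) s
      reachesTarget : perform f₁ s ≈ f₂

  -- m is OPT(K); there is no such m when the target cannot be reached.
  record IsOPT (m : ℕ) : Set where
    field
      attained : ∃[ s ] IsSwapSequence s × length s ≡ m
      minimal  : ∀ {s} → IsSwapSequence s → m ≤ length s

  -- Run σ ps s: started in configuration σ, treating the pairs ps in order can
  -- produce the swaps s.  Any shortest path may be picked in each round.
  data Run (σ : Config n) : List (Fin n × Fin n) → List Swap → Set where
    done  : Run σ [] []
    round : ∀ {u v ps p s} →
            IsShortestPath u v p →
            Run (perform σ (exchange σ v p)) ps s →
            Run σ ((u , v) ∷ ps) (exchange σ v p ++ s)

  -- s is an output of the algorithm on K.  The order of the cycles and the
  -- vertex at which each one begins are left open, as are the shortest paths.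
  Returns : List Swap → Set
  Returns s = ∃[ cs ] IsCycleDecomposition π cs × Run f₁ (schedule cs) s

  IsALG : ℕ → Set
  IsALG m = ∃[ s ] Returns s × length s ≡ m

{-# OPTIONS --safe #-}
-- Upper bound.  Write a path as r, w, v and let A bubble a token along r, w.
-- The round along this path is A, then the swap (w , v), then A⁻¹, and so its
-- net effect is the transposition of its end points; the transpositions of a
-- cycle compose to that cycle.
--
-- Factor 4.  A round costs at most twice the distance from u to π u, where the
-- vertices u are distinct over all rounds.  This distance is at most the number
-- of swaps of an optimal sequence that move the token starting on u, and each
-- swap moves at most two tokens.
module Submission where

open import Data.Bool using (if_then_else_)
open import Data.Fin using (Fin)
open import Data.Fin.Permutation using (_⟨$⟩ʳ_; _⟨$⟩ˡ_; Permutation′; inverseˡ; inverseʳ)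
open import Data.Fin.Permutation.Components using (transpose; transpose-inverse)
open import Data.Fin.Properties using (_≟_)
open import Data.List using (List; []; _∷_; [_]; _++_; concatMap; head; last; length; map; reverse)
open import Data.List.Membership.Propositional using (_∈_)
open import Data.List.Membership.Propositional.Properties using (∈-++⁻)
open import Data.List.NonEmpty using (_∷_; toList)
open import Data.List.Properties using (length-++; length-map; length-reverse; map-++; map-∘; reverse-++; unfold-reverse; ++-assoc)
open import Data.List.Relation.Binary.Permutation.Propositional using (↭-sym)
open import Data.List.Relation.Binary.Permutation.Propositional.Properties using (All-resp-↭; ↭-reverse; map⁺)
open import Data.List.Relation.Unary.All as All using (All; []; _∷_)
import Data.List.Relation.Unary.All.Properties as All
open import Data.List.Relation.Unary.AllPairs using ([]; _∷_)
open import Data.List.Relation.Unary.Any using (here; there; any?)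
open import Data.List.Relation.Unary.Linked using (Linked; []; [-]; _∷_)
open import Data.List.Relation.Unary.Unique.Propositional using (Unique)
import Data.List.Relation.Unary.Unique.Propositional.Properties as Unique
open import Data.Maybe using (just)
open import Data.Nat using (ℕ; suc; _+_; _*_; _≤_; z≤n; s≤s)
open import Data.Nat.ListAction using (sum)
open import Data.Nat.ListAction.Properties using (sum-++; sum-↭)
open import Data.Nat.Properties hiding (_≟_)
open import Algebra.Properties.CommutativeSemigroup +-commutativeSemigroup using (interchange)
open import Data.Product using (_×_; _,_; ∃-syntax; ∃₂; proj₁; proj₂; uncurry) renaming (swap to flip)
open import Data.Sum using (_⊎_; inj₁; inj₂)
open import Function using (_∘_)
open import Relation.Binary using (Rel)
open import Relation.Binary.PropositionalEquality hiding ([_])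
open import Relation.Nullary using (yes; no; does; contradiction)
open import Relation.Nullary.Decidable using (¬?; dec-true; dec-false)
open import Defs

-- Lists: distinctness, linked lists and sums.

Unique-++⁻ : ∀ {A : Set} (xs : List A) {ys} → Unique (xs ++ ys) →
             Unique xs × Unique ys × All (λ x → All (x ≢_) ys) xs
Unique-++⁻ []       ys!            = [] , ys! , []
Unique-++⁻ (x ∷ xs) (x∉ ∷ xsys!) with Unique-++⁻ xs xsys!
... | xs! , ys! , xs#ys = All.++⁻ˡ xs x∉ ∷ xs! , ys! , All.++⁻ʳ xs x∉ ∷ xs#ys

Linked-++⁻ˡ : ∀ {A : Set} {ℓ} {R : Rel A ℓ} xs {ys} → Linked R (xs ++ ys) → Linked R xs
Linked-++⁻ˡ []           _          = []
Linked-++⁻ˡ (x ∷ [])     _          = [-]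
Linked-++⁻ˡ (x ∷ y ∷ xs) (xRy ∷ Rs) = xRy ∷ Linked-++⁻ˡ (y ∷ xs) Rs

All-reverse⁺ : ∀ {A : Set} {p} {P : A → Set p} {xs} → All P xs → All P (reverse xs)
All-reverse⁺ {xs = xs} = All-resp-↭ (↭-sym (↭-reverse xs))

sum-map-+ : ∀ {A : Set} (f g : A → ℕ) xs →
            sum (map (λ x → f x + g x) xs) ≡ sum (map f xs) + sum (map g xs)
sum-map-+ f g []       = refl
sum-map-+ f g (x ∷ xs) =
  trans (cong (f x + g x +_) (sum-map-+ f g xs)) (interchange (f x) (g x) _ _)

sum-map-++ : ∀ {A : Set} (f : A → ℕ) xs ys →
             sum (map f (xs ++ ys)) ≡ sum (map f xs) + sum (map f ys)
sum-map-++ f xs ys = trans (cong sum (map-++ f xs ys)) (sum-++ (map f xs) (map f ys))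

-- Exposes a path with at least one edge in the form r, w, v, in which a round is analysed, and sets
-- the one-vertex path apart.
last-split : ∀ {A : Set} {v : A} p → last p ≡ just v →
             p ≡ [ v ] ⊎ ∃₂ λ r w → p ≡ r ++ w ∷ v ∷ []
last-split (x ∷ [])     refl = inj₁ refl
last-split (x ∷ y ∷ p) eq with last-split (y ∷ p) eq
... | inj₁ refl         = inj₂ ([] , x , refl)
... | inj₂ (r , w , eq′) = inj₂ (x ∷ r , w , cong (x ∷_) eq′)

module _ {n : ℕ} where

  -- Transpositions of vertices.

  transpose-cases : (i j k : Fin n) →
                    (k ≡ i × transpose i j k ≡ j) ⊎
                    (k ≡ j × transpose i j k ≡ i) ⊎
                    (k ≢ i × k ≢ j × transpose i j k ≡ k)
  transpose-cases i j k with k ≟ i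
  ... | yes k≡i = inj₁ (k≡i , refl)
  ... | no  k≢i with k ≟ j
  ...   | yes k≡j = inj₂ (inj₁ (k≡j , refl))
  ...   | no  k≢j = inj₂ (inj₂ (k≢i , k≢j , refl))

  transpose-iji : (i j : Fin n) → transpose i j i ≡ j
  transpose-iji i j rewrite dec-true (i ≟ i) refl = refl

  transpose-ijj : (i j : Fin n) → transpose i j j ≡ i
  transpose-ijj i j with transpose-cases i j j
  ... | inj₁ (j≡i , eq)             = trans eq j≡i
  ... | inj₂ (inj₁ (_ , eq))        = eq
  ... | inj₂ (inj₂ (_ , j≢j , _)) = contradiction refl j≢j

  transpose-ijk : ∀ {i j k : Fin n} → k ≢ i → k ≢ j → transpose i j k ≡ k
  transpose-ijk {i} {j} {k} k≢i k≢j
    rewrite dec-false (k ≟ i) k≢i | dec-false (k ≟ j) k≢j = refl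

  transpose-ii : (i k : Fin n) → transpose i i k ≡ k
  transpose-ii i k with transpose-cases i i k
  ... | inj₁ (k≡i , eq)           = trans eq (sym k≡i)
  ... | inj₂ (inj₁ (k≡i , eq))    = trans eq (sym k≡i)
  ... | inj₂ (inj₂ (_ , _ , eq)) = eq

  transpose-injective : (i j : Fin n) → ∀ {k l} → transpose i j k ≡ transpose i j l → k ≡ l
  transpose-injective i j eq =
    trans (sym (transpose-inverse j i)) (trans (cong (transpose j i) eq) (transpose-inverse j i))

  -- Injectivity carries `k ≢ i` and `k ≢ j` over to the images, so `f k` falls under the same case
  -- as `k`.
  transpose-natural : (f : Fin n → Fin n) → (∀ {k l} → f k ≡ f l → k ≡ l) → ∀ i j k →
                      transpose (f i) (f j) (f k) ≡ f (transpose i j k)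
  transpose-natural f inj i j k with transpose-cases i j k
  ... | inj₁ (refl , eq)             = trans (transpose-iji (f k) (f j)) (cong f (sym eq))
  ... | inj₂ (inj₁ (refl , eq))      = trans (transpose-ijj (f i) (f k)) (cong f (sym eq))
  ... | inj₂ (inj₂ (k≢i , k≢j , eq)) = trans (transpose-ijk (k≢i ∘ inj) (k≢j ∘ inj)) (cong f (sym eq))

  -- Swap sequences as permutations of the vertices.

  follow : List (Swap {n}) → Fin n → Fin n
  follow []            x = x
  follow ((u , v) ∷ s) x = follow s (transpose u v x)

  -- Swaps act on locations only, so their effect can be studied on vertices, without reference to a
  -- configuration.
  perform-follow : ∀ (σ : Config n) s t → perform σ s ⟨$⟩ʳ t ≡ follow s (σ ⟨$⟩ʳ t)
  perform-follow σ []            t = refl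
  perform-follow σ ((u , v) ∷ s) t = perform-follow (swap σ (u , v)) s t

  follow-++ : ∀ s s′ x → follow (s ++ s′) x ≡ follow s′ (follow s x)
  follow-++ []            s′ x = refl
  follow-++ ((u , v) ∷ s) s′ x = follow-++ s s′ (transpose u v x)

  Avoids : Fin n → Swap {n} → Set
  Avoids x (u , v) = x ≢ u × x ≢ v

  follow-avoids : ∀ {s x} → All (Avoids x) s → follow s x ≡ x
  follow-avoids                     []                    = refl
  follow-avoids {(u , v) ∷ s} {x} ((x≢u , x≢v) ∷ avoids) =
    trans (cong (follow s) (transpose-ijk x≢u x≢v)) (follow-avoids avoids)

  -- Each pair is flipped as well as the order reversed, so that undoing the edges of a path yields
  -- literally the edges of the reversed path.
  undo : List (Swap {n}) → List (Swap {n})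
  undo s = reverse (map flip s)

  follow-undo : ∀ s x → follow (undo s) (follow s x) ≡ x
  follow-undo []            x = refl
  follow-undo ((u , v) ∷ s) x = begin
    follow (undo ((u , v) ∷ s)) y            ≡⟨ cong (λ s′ → follow s′ y) (unfold-reverse (v , u) (map flip s)) ⟩
    follow (undo s ++ [ v , u ]) y           ≡⟨ follow-++ (undo s) [ v , u ] y ⟩
    transpose v u (follow (undo s) y)        ≡⟨ cong (transpose v u) (follow-undo s (transpose u v x)) ⟩
    transpose v u (transpose u v x)          ≡⟨ transpose-inverse v u ⟩
    x                                        ∎
    where
    open ≡-Reasoning
    y = follow s (transpose u v x)

  follow-injective : ∀ s {x y} → follow s x ≡ follow s y → x ≡ y
  follow-injective s eq =
    trans (sym (follow-undo s _)) (trans (cong (follow (undo s)) eq) (follow-undo s _))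

  -- Conjugation of a transposition: by `transpose-natural` the middle swap can be pulled back to
  -- the front of `s`, after which `s` and `undo s` cancel.
  follow-conjugate : ∀ s u v x →
    follow (s ++ (follow s u , follow s v) ∷ undo s) x ≡ transpose u v x
  follow-conjugate s u v x = begin
    follow (s ++ (follow s u , follow s v) ∷ undo s) x                      ≡⟨ follow-++ s _ x ⟩
    follow (undo s) (transpose (follow s u) (follow s v) (follow s x))      ≡⟨ cong (follow (undo s)) (transpose-natural (follow s) (follow-injective s) u v x) ⟩
    follow (undo s) (follow s (transpose u v x))                            ≡⟨ follow-undo s _ ⟩
    transpose u v x                                                         ∎
    where open ≡-Reasoning

  -- Edges of a path, reversal and bubbling.

  consecutive-++ : ∀ (xs : List (Fin n)) y ys →
    consecutive (xs ++ y ∷ ys) ≡ consecutive (xs ++ [ y ]) ++ consecutive (y ∷ ys)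
  consecutive-++ []            y ys = refl
  consecutive-++ (x ∷ [])      y ys = refl
  consecutive-++ (x ∷ x′ ∷ xs) y ys = cong ((x , x′) ∷_) (consecutive-++ (x′ ∷ xs) y ys)

  consecutive-reverse : ∀ (xs : List (Fin n)) → consecutive (reverse xs) ≡ undo (consecutive xs)
  consecutive-reverse []           = refl
  consecutive-reverse (x ∷ [])     = refl
  consecutive-reverse (x ∷ y ∷ ys) = begin
    consecutive (reverse (x ∷ y ∷ ys))                    ≡⟨ cong consecutive (reverse-++ (x ∷ y ∷ []) ys) ⟩
    consecutive (reverse ys ++ y ∷ x ∷ [])                ≡⟨ consecutive-++ (reverse ys) y [ x ] ⟩
    consecutive (reverse ys ++ [ y ]) ++ [ y , x ]        ≡⟨ cong (λ zs → consecutive zs ++ [ y , x ]) (unfold-reverse y ys) ⟨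
    consecutive (reverse (y ∷ ys)) ++ [ y , x ]           ≡⟨ cong (_++ [ y , x ]) (consecutive-reverse (y ∷ ys)) ⟩
    undo (consecutive (y ∷ ys)) ++ [ y , x ]              ≡⟨ unfold-reverse (y , x) (map flip (consecutive (y ∷ ys))) ⟨
    undo (consecutive (x ∷ y ∷ ys))                       ∎
    where open ≡-Reasoning

  consecutive-Linked : ∀ {ℓ} {R : Rel (Fin n) ℓ} {xs} → Linked R xs → All (uncurry R) (consecutive xs)
  consecutive-Linked []         = []
  consecutive-Linked [-]        = []
  consecutive-Linked (xRy ∷ Rs) = xRy ∷ consecutive-Linked Rs

  consecutive-avoids : ∀ {x : Fin n} {xs} → All (x ≢_) xs → All (Avoids x) (consecutive xs)
  consecutive-avoids []                   = []
  consecutive-avoids (_ ∷ [])             = []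
  consecutive-avoids (x≢u ∷ x≢v ∷ x≢vs) = (x≢u , x≢v) ∷ consecutive-avoids (x≢v ∷ x≢vs)

  follow-bubble : ∀ p {u v} → head p ≡ just u → last p ≡ just v → follow (bubbleAlong p) u ≡ v
  follow-bubble (x ∷ [])    refl refl = refl
  follow-bubble (x ∷ y ∷ p) refl eq   =
    trans (cong (follow (consecutive (y ∷ p))) (transpose-iji x y)) (follow-bubble (y ∷ p) refl eq)

  -- Effect and cost of a single round.

  suffixFrom-second : ∀ {v w : Fin n} xs → v ≢ w → suffixFrom w (v ∷ w ∷ xs) ≡ w ∷ xs
  suffixFrom-second {v} {w} xs v≢w
    rewrite dec-true (¬? (v ≟ w)) v≢w | dec-false (¬? (w ≟ w)) (λ w≢w → w≢w refl) = refl

  exchange-singleton : ∀ (σ : Config n) v → exchange σ v [ v ] ≡ []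
  exchange-singleton σ v
    rewrite inverseʳ σ {v} | dec-false (¬? (v ≟ v)) (λ v≢v → v≢v refl) = refl

  module _ (σ : Config n) (r : List (Fin n)) (w v : Fin n) (p! : Unique (r ++ w ∷ v ∷ [])) where

    private
      p = r ++ w ∷ v ∷ []
      A = bubbleAlong (r ++ [ w ])

      bubble-split : bubbleAlong p ≡ A ++ [ w , v ]
      bubble-split = consecutive-++ r w [ v ]

      v≢w : v ≢ w
      v≢w with Unique-++⁻ r p!
      ... | _ , (w≢v ∷ _) ∷ _ , _ = w≢v ∘ sym

    -- The vertices of the path are distinct, so no swap before the last one touches its end `v`.
    follow-init : follow A v ≡ v
    follow-init = follow-avoids (consecutive-avoids (All.map (λ { (u≢v ∷ []) → u≢v ∘ sym }) r∷ʳw#v))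
      where
      r∷ʳw#v = proj₂ (proj₂ (Unique-++⁻ (r ++ [ w ]) (subst Unique (sym (++-assoc r [ w ] [ v ])) p!)))

    -- The token on `v` rests until the final swap `(w , v)`, which pushes it back by one edge.
    displaced : perform σ (bubbleAlong p) ⟨$⟩ʳ (σ ⟨$⟩ˡ v) ≡ w
    displaced = begin
      perform σ (bubbleAlong p) ⟨$⟩ʳ (σ ⟨$⟩ˡ v)      ≡⟨ perform-follow σ (bubbleAlong p) _ ⟩
      follow (bubbleAlong p) (σ ⟨$⟩ʳ (σ ⟨$⟩ˡ v))     ≡⟨ cong (follow (bubbleAlong p)) (inverseʳ σ) ⟩
      follow (bubbleAlong p) v                       ≡⟨ cong (λ s → follow s v) bubble-split ⟩
      follow (A ++ [ w , v ]) v                      ≡⟨ follow-++ A [ w , v ] v ⟩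
      transpose w v (follow A v)                     ≡⟨ cong (transpose w v) follow-init ⟩
      transpose w v v                                ≡⟨ transpose-ijj w v ⟩
      w                                              ∎
      where open ≡-Reasoning

    -- As the displaced token sits on `w`, the way back skips the edge between `v` and `w`; what
    -- remains is the reversal of r, w, whose swaps are `undo A`.
    exchange-conjugate : exchange σ v p ≡ A ++ (w , v) ∷ undo A
    exchange-conjugate = begin
      bubbleAlong p ++ bubbleAlong (suffixFrom (perform σ (bubbleAlong p) ⟨$⟩ʳ (σ ⟨$⟩ˡ v)) (reverse p))
        ≡⟨ cong₂ (λ x xs → bubbleAlong p ++ bubbleAlong (suffixFrom x xs)) displaced (reverse-++ r (w ∷ v ∷ [])) ⟩
      bubbleAlong p ++ bubbleAlong (suffixFrom w (v ∷ w ∷ reverse r))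
        ≡⟨ cong₂ (λ s xs → s ++ bubbleAlong xs) bubble-split (suffixFrom-second (reverse r) v≢w) ⟩
      (A ++ [ w , v ]) ++ bubbleAlong (w ∷ reverse r)
        ≡⟨ ++-assoc A [ w , v ] _ ⟩
      A ++ (w , v) ∷ bubbleAlong (w ∷ reverse r)
        ≡⟨ cong (λ xs → A ++ (w , v) ∷ bubbleAlong xs) (reverse-++ r [ w ]) ⟨
      A ++ (w , v) ∷ bubbleAlong (reverse (r ++ [ w ]))
        ≡⟨ cong (λ s → A ++ (w , v) ∷ s) (consecutive-reverse (r ++ [ w ])) ⟩
      A ++ (w , v) ∷ undo A ∎
      where open ≡-Reasoning

    -- `A` carries `u` to `w` and fixes `v`, so the middle swap exchanges the images of `u` and `v`
    -- under `A`, and `follow-conjugate` applies.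
    exchange-follow : ∀ {u} → head (r ++ [ w ]) ≡ just u → ∀ x → follow (exchange σ v p) x ≡ transpose u v x
    exchange-follow {u} starts x = begin
      follow (exchange σ v p) x                            ≡⟨ cong (λ s → follow s x) exchange-conjugate ⟩
      follow (A ++ (w , v) ∷ undo A) x                     ≡⟨ cong₂ (λ y z → follow (A ++ (y , z) ∷ undo A) x) (follow-bubble (r ++ [ w ]) starts (last-∷ʳ r)) follow-init ⟨
      follow (A ++ (follow A u , follow A v) ∷ undo A) x   ≡⟨ follow-conjugate A u v x ⟩
      transpose u v x                                      ∎
      where
      open ≡-Reasoning
      last-∷ʳ : ∀ xs → last (xs ++ [ w ]) ≡ just w
      last-∷ʳ []           = refl
      last-∷ʳ (_ ∷ [])     = refl
      last-∷ʳ (_ ∷ y ∷ xs) = last-∷ʳ (y ∷ xs)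

    exchange-length : length (exchange σ v p) ≤ 2 * pathLength p
    exchange-length = begin
      length (exchange σ v p)                ≡⟨ cong length exchange-conjugate ⟩
      length (A ++ (w , v) ∷ undo A)         ≡⟨ length-++ A ⟩
      length A + suc (length (undo A))       ≡⟨ cong (λ k → length A + suc k) (trans (length-reverse (map flip A)) (length-map flip A)) ⟩
      -- The round has one swap more than twice the length of `A`, and the path one edge more than
      -- `A`; the bound gives away a single swap.
      length A + suc (length A)              ≤⟨ +-mono-≤ (n≤1+n (length A)) (≤-reflexive (sym (+-identityʳ _))) ⟩
      2 * suc (length A)                     ≡⟨ cong (2 *_) (trans (length-++ A) (+-comm (length A) 1)) ⟨
      2 * length (A ++ [ w , v ])            ≡⟨ cong (λ s → 2 * length s) bubble-split ⟨
      2 * pathLength p                       ∎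
      where open ≤-Reasoning

    exchange-edges : ∀ {ℓ} {R : Rel (Fin n) ℓ} → (∀ {x y} → R x y → R y x) →
                     Linked R p → All (uncurry R) (exchange σ v p)
    exchange-edges R-sym Rp with All.++⁻ A (subst (All _) bubble-split (consecutive-Linked Rp))
    ... | RA , Rwv ∷ [] = subst (All _) (sym exchange-conjugate)
      (All.++⁺ RA (Rwv ∷ All-reverse⁺ (All.map⁺ (All.map R-sym RA))))

  -- Cycles as products of transpositions.

  -- The induction needs open arcs of a cycle, with `z` the successor of the last vertex. Applying
  -- the pairs from the back advances every vertex by one, except that the last one wraps round to
  -- the head `a` of the arc.
  rotate : ∀ (π : Permutation′ n) {x z} a as → Unique (a ∷ as) →
           Linked (λ x y → π ⟨$⟩ʳ x ≡ y) (a ∷ as ++ [ z ]) → x ∈ a ∷ as →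
           let y = follow (reverse (consecutive (a ∷ as))) x in
           (y ∈ as × y ≡ π ⟨$⟩ʳ x) ⊎ (y ≡ a × π ⟨$⟩ʳ x ≡ z)
  rotate π a [] _ (πa≡z ∷ _) (here refl) = inj₂ (refl , πa≡z)
  rotate π {x} a (b ∷ as) (a∉@(a≢b ∷ a≢as) ∷ b∷as!@(b≢as ∷ _)) (πa≡b ∷ πs) x∈
    rewrite unfold-reverse (a , b) (consecutive (b ∷ as))
          | follow-++ (reverse (consecutive (b ∷ as))) [ a , b ] x
    with x∈
  -- The pairs applied earlier avoid `a`, so only the final transposition moves it.
  ... | here refl
    rewrite follow-avoids (All-reverse⁺ (consecutive-avoids a∉)) | transpose-iji a b
    = inj₁ (here refl , sym πa≡b)
  ... | there x∈b∷as with rotate π b as b∷as! πs x∈b∷as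
  -- The image lies beyond `b`, so the final transposition of `a` and `b` fixes it.
  ...   | inj₁ (y∈as , y≡πx)
    rewrite transpose-ijk (≢-sym (All.lookup a≢as y∈as)) (≢-sym (All.lookup b≢as y∈as))
    = inj₁ (there y∈as , y≡πx)
  -- The vertex that wrapped round to `b` is carried on to the new head `a`.
  ...   | inj₂ (y≡b , πx≡z) rewrite y≡b | transpose-ijj a b = inj₂ (refl , πx≡z)

  -- In a closed cycle the successor `z` of the last vertex is the head itself, so wrapping round
  -- also agrees with `π`.
  cycle-follow : ∀ (π : Permutation′ n) {x} c → Unique (toList c) → IsCycle π c → x ∈ toList c →
                 let y = follow (reverse (consecutive (toList c))) x in
                 y ∈ toList c × y ≡ π ⟨$⟩ʳ x
  cycle-follow π (v ∷ vs) c! cyc x∈ with rotate π v vs c! cyc x∈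
  ... | inj₁ (y∈vs , y≡πx) = there y∈vs , y≡πx
  ... | inj₂ (y≡v , πx≡v)  = here y≡v , trans y≡v (sym πx≡v)

  schedule-avoids : ∀ {x : Fin n} cs → All (x ≢_) (concatMap toList cs) → All (Avoids x) (schedule cs)
  schedule-avoids []       _  = []
  schedule-avoids (c ∷ cs) x∉ = All.++⁺
    (All-reverse⁺ (consecutive-avoids (All.++⁻ˡ (toList c) x∉)))
    (schedule-avoids cs (All.++⁻ʳ (toList c) x∉))

  -- A vertex and its image under `π` lie in the same cycle, and by disjointness the pairs of all
  -- earlier and later cycles leave them fixed.
  schedule-follow : ∀ (π : Permutation′ n) {x} cs → All (IsCycle π) cs → Unique (concatMap toList cs) →
                    x ∈ concatMap toList cs → follow (schedule cs) x ≡ π ⟨$⟩ʳ x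
  schedule-follow π {x} (c ∷ cs) (cyc ∷ cycs) cs! x∈
    rewrite follow-++ (reverse (consecutive (toList c))) (schedule cs) x
    with Unique-++⁻ (toList c) cs! | ∈-++⁻ (toList c) x∈
  ... | c! , _ , c#cs | inj₁ x∈c with cycle-follow π c c! cyc x∈c
  ...   | y∈c , y≡πx = trans (follow-avoids (schedule-avoids cs (All.lookup c#cs y∈c))) y≡πx
  schedule-follow π {x} (c ∷ cs) (cyc ∷ cycs) cs! x∈
      | _ , cs!′ , c#cs | inj₂ x∈cs = trans
    (cong (follow (schedule cs)) (follow-avoids (All-reverse⁺ (consecutive-avoids
      (All.map (λ y≢cs x≡y → All.lookup y≢cs x∈cs (sym x≡y)) c#cs)))))
    (schedule-follow π cs cycs cs!′ x∈cs)

  schedule-pairs : ∀ (π : Permutation′ n) {cs} → All (IsCycle π) cs →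
                   All (λ (u , v) → π ⟨$⟩ʳ u ≡ v) (schedule cs)
  schedule-pairs π                      []           = []
  schedule-pairs π {cs = (v ∷ vs) ∷ _} (cyc ∷ cycs) = All.++⁺
    (All-reverse⁺ (consecutive-Linked (Linked-++⁻ˡ (v ∷ vs) cyc)))
    (schedule-pairs π cycs)

  -- Summing a weight over the pairs of the schedule.

  module _ (f : Fin n → ℕ) where

    -- Each position but the last is the first component of exactly one pair.
    sum-consecutive : ∀ xs → sum (map (f ∘ proj₁) (consecutive xs)) ≤ sum (map f xs)
    sum-consecutive []           = z≤n
    sum-consecutive (x ∷ [])     = z≤n
    sum-consecutive (x ∷ y ∷ xs) = +-monoʳ-≤ (f x) (sum-consecutive (y ∷ xs))

    sum-schedule : ∀ cs → sum (map (f ∘ proj₁) (schedule cs)) ≤ sum (map f (concatMap toList cs))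
    sum-schedule []       = z≤n
    sum-schedule (c ∷ cs) = begin
      sum (map g (reverse ps ++ schedule cs))                        ≡⟨ sum-map-++ g (reverse ps) (schedule cs) ⟩
      sum (map g (reverse ps)) + sum (map g (schedule cs))           ≡⟨ cong (_+ sum (map g (schedule cs))) (sum-↭ (map⁺ g (↭-reverse ps))) ⟩
      sum (map g ps) + sum (map g (schedule cs))                     ≤⟨ +-mono-≤ (sum-consecutive (toList c)) (sum-schedule cs) ⟩
      sum (map f (toList c)) + sum (map f (concatMap toList cs))     ≡⟨ sum-map-++ f (toList c) (concatMap toList cs) ⟨
      sum (map f (concatMap toList (c ∷ cs)))                        ∎
      where
      open ≤-Reasoning
      g  = f ∘ proj₁
      ps = consecutive (toList c)

  -- Counting how often tokens are moved.

  δ : Fin n → Fin n → ℕ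
  δ a x = if does (x ≟ a) then 1 else 0

  -- If no swap of `s` has equal ends, this is the number of swaps that move the token starting on
  -- `x`; the vertex argument tracks that token.
  moves : List (Swap {n}) → Fin n → ℕ
  moves []            x = 0
  moves ((a , b) ∷ s) x = (δ a x + δ b x) + moves s (transpose a b x)

  sum-δ-∉ : ∀ {a xs} → All (a ≢_) xs → sum (map (δ a) xs) ≡ 0
  sum-δ-∉ []                          = refl
  sum-δ-∉ {a} {x ∷ _} (a≢x ∷ a≢xs) rewrite dec-false (x ≟ a) (≢-sym a≢x) = sum-δ-∉ a≢xs

  sum-δ : ∀ a {xs} → Unique xs → sum (map (δ a) xs) ≤ 1
  sum-δ a []                   = z≤n
  sum-δ a {x ∷ _} (x∉xs ∷ xs!) with x ≟ a
  ... | yes refl = ≤-reflexive (cong suc (sum-δ-∉ x∉xs))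
  ... | no  _    = sum-δ a xs!

  -- Double counting: at most one tracked token is on each end of a swap. The list of vertices is
  -- arbitrary because the induction replaces it by its image under the first swap, which is again
  -- free of repetitions.
  sum-moves : ∀ s {xs} → Unique xs → sum (map (moves s) xs) ≤ 2 * length s
  sum-moves []            {xs} _   = ≤-reflexive (sum-0 xs)
    where
    sum-0 : ∀ (ys : List (Fin n)) → sum (map (λ _ → 0) ys) ≡ 0
    sum-0 []       = refl
    sum-0 (_ ∷ ys) = sum-0 ys
  sum-moves ((a , b) ∷ s) {xs} xs! = begin
    sum (map (λ x → (δ a x + δ b x) + moves s (τ x)) xs)
      ≡⟨ sum-map-+ (λ x → δ a x + δ b x) (moves s ∘ τ) xs ⟩
    sum (map (λ x → δ a x + δ b x) xs) + sum (map (moves s ∘ τ) xs)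
      ≡⟨ cong₂ _+_ (sum-map-+ (δ a) (δ b) xs) (cong sum (map-∘ xs)) ⟩
    (sum (map (δ a) xs) + sum (map (δ b) xs)) + sum (map (moves s) (map τ xs))
      ≤⟨ +-mono-≤ (+-mono-≤ (sum-δ a xs!) (sum-δ b xs!)) (sum-moves s (Unique.map⁺ (transpose-injective a b) xs!)) ⟩
    2 + 2 * length s
      ≡⟨ *-suc 2 (length s) ⟨
    2 * suc (length s) ∎
    where
    open ≤-Reasoning
    τ = transpose a b

-- Paths traced by tokens in the graph.

module _ {n : ℕ} (K : Instance n) where
  open Instance K hiding (sym)
  open Graph graph using () renaming (sym to Adj-sym)
  open IsPath
  open IsShortestPath

  trivial-path : ∀ x → IsPath K x x [ x ]
  trivial-path x = record { starts = refl ; ends = refl ; edges = [-] ; distinct = [] ∷ [] }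

  path-suffix : ∀ {x y z q} → IsPath K y z q → x ∈ q →
                ∃[ q′ ] IsPath K x z q′ × pathLength q′ ≤ pathLength q
  path-suffix {q = _ ∷ q} q-path (here refl) = _ , record { IsPath q-path ; starts = refl } , ≤-refl
  path-suffix {q = _ ∷ _ ∷ _}
    record { ends = ends ; edges = _ ∷ edges ; distinct = _ ∷ distinct } (there x∈q)
    with path-suffix record { starts = refl ; ends = ends ; edges = edges ; distinct = distinct } x∈q
  ... | q′ , q′-path , q′≤q = q′ , q′-path , m≤n⇒m≤1+n q′≤q

  -- If `x` already lies on the path, prepending would repeat a vertex, so the path is cut at `x`
  -- instead, which only shortens it.
  path-prepend : ∀ {x y z q} → Adj x y → IsPath K y z q →
                 ∃[ q′ ] IsPath K x z q′ × pathLength q′ ≤ suc (pathLength q)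
  path-prepend {x} {q = q} x~y q-path with any? (x ≟_) q
  path-prepend x~y q-path | yes x∈q with path-suffix q-path x∈q
  ... | q′ , q′-path , q′≤q = q′ , q′-path , m≤n⇒m≤1+n q′≤q
  path-prepend {x} {q = y ∷ q} x~y record { starts = refl ; ends = ends ; edges = edges ; distinct = distinct } | no x∉q =
    x ∷ y ∷ q ,
    record { starts = refl ; ends = ends ; edges = x~y ∷ edges ; distinct = All.¬Any⇒All¬ _ x∉q ∷ distinct } ,
    ≤-refl

  -- The token starting on `x` crosses one edge whenever it is moved. Its walk, with detours cut
  -- out, bounds a distance by a number of moves.
  moves-path : ∀ {s} → All (uncurry Adj) s → ∀ x →
               ∃[ q ] IsPath K x (follow s x) q × pathLength q ≤ moves s x
  moves-path                 []           x = [ x ] , trivial-path x , z≤n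
  moves-path {(a , b) ∷ s} (a~b ∷ edges) x
    with moves-path edges (transpose a b x) | transpose-cases a b x
  ... | q , q-path , q≤ | inj₁ (refl , eq)
    with path-prepend (subst (Adj x) (sym eq) a~b) q-path
  -- The end of the swap that carries the token counts 1 and pays for the prepended edge; the count
  -- of the other end is discarded.
  ...   | q′ , q′-path , q′≤ rewrite dec-true (x ≟ x) refl =
    q′ , q′-path , ≤-trans q′≤ (s≤s (≤-trans q≤ (m≤n+m _ (δ b x))))
  moves-path {(a , b) ∷ s} (a~b ∷ edges) x
      | q , q-path , q≤ | inj₂ (inj₁ (refl , eq))
    with path-prepend (subst (Adj x) (sym eq) (Adj-sym a~b)) q-path
  ...   | q′ , q′-path , q′≤ rewrite dec-true (x ≟ x) refl | +-comm (δ a x) 1 =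
    q′ , q′-path , ≤-trans q′≤ (s≤s (≤-trans q≤ (m≤n+m _ (δ a x))))
  moves-path {(a , b) ∷ s} (a~b ∷ edges) x
      | q , q-path , q≤ | inj₂ (inj₂ (_ , _ , eq)) =
    q , subst (λ y → IsPath K y (follow s (transpose a b x)) q) eq q-path , ≤-trans q≤ (m≤n+m _ _)

  -- Rounds and runs of the algorithm.

  round-correct : ∀ σ {u v p} → IsPath K u v p →
    All (uncurry Adj) (exchange σ v p) ×
    (∀ x → follow (exchange σ v p) x ≡ transpose u v x) ×
    length (exchange σ v p) ≤ 2 * pathLength p
  round-correct σ {u} {v} {p} p-path with last-split p (ends p-path)
  -- On a one-vertex path `u` and `v` coincide: the round is empty and its transposition trivial.
  ... | inj₁ refl with refl ← starts p-path rewrite exchange-singleton σ v =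
    [] , (λ x → sym (transpose-ii u x)) , z≤n
  ... | inj₂ (r , w , refl) =
    exchange-edges σ r w v (distinct p-path) Adj-sym (edges p-path) ,
    exchange-follow σ r w v (distinct p-path) (head-init r (starts p-path)) ,
    exchange-length σ r w v (distinct p-path)
    where
    head-init : ∀ r → head (r ++ w ∷ v ∷ []) ≡ just u → head (r ++ [ w ]) ≡ just u
    head-init []      eq = eq
    head-init (_ ∷ _) eq = eq

  run-edges : ∀ {σ ps s} → Run K σ ps s → All (uncurry Adj) s
  run-edges         done            = []
  run-edges {σ} (round p-short run) =
    All.++⁺ (proj₁ (round-correct σ (isPath p-short))) (run-edges run)

  -- Each round acts as the transposition of its pair in every configuration, so the schedule,
  -- itself read as a list of swaps, has the same effect as the run.
  run-follow : ∀ {σ ps s} → Run K σ ps s → ∀ x → follow s x ≡ follow ps x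
  run-follow done x = refl
  run-follow {σ} (round {u} {v} {ps} {p} {s} p-short run) x = begin
    follow (exchange σ v p ++ s) x          ≡⟨ follow-++ (exchange σ v p) s x ⟩
    follow s (follow (exchange σ v p) x)    ≡⟨ cong (follow s) (proj₁ (proj₂ (round-correct σ (isPath p-short))) x) ⟩
    follow s (transpose u v x)              ≡⟨ run-follow run (transpose u v x) ⟩
    follow ps (transpose u v x)             ∎
    where open ≡-Reasoning

  -- The weight `f u` stands for any bound on the distance from `u` to `v` witnessed by a path; the
  -- chosen shortest path is no longer than the witness.
  run-length : ∀ (f : Fin n → ℕ) {σ ps s} →
    All (λ (u , v) → ∃[ q ] IsPath K u v q × pathLength q ≤ f u) ps →
    Run K σ ps s → length s ≤ 2 * sum (map (f ∘ proj₁) ps)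
  run-length f []                            done = z≤n
  run-length f {σ} ((q , q-path , q≤fu) ∷ paths) (round {u} {v} {ps} {p} {s} p-short run) = begin
    length (exchange σ v p ++ s)                   ≡⟨ length-++ (exchange σ v p) ⟩
    length (exchange σ v p) + length s             ≤⟨ +-mono-≤ (proj₂ (proj₂ (round-correct σ (isPath p-short)))) (run-length f paths run) ⟩
    2 * pathLength p + 2 * F                       ≤⟨ +-monoˡ-≤ (2 * F) (*-monoʳ-≤ 2 (≤-trans (shortest p-short q-path) q≤fu)) ⟩
    2 * f u + 2 * F                                ≡⟨ *-distribˡ-+ 2 (f u) F ⟨
    2 * (f u + F)                                  ∎
    where
    open ≤-Reasoning
    F = sum (map (f ∘ proj₁) ps)

  -- Correctness and length of the output.

  module _ {s : List Swap} (returned : Returns K s) where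
    private
      cs  = proj₁ returned
      run = proj₂ (proj₂ returned)
      open IsCycleDecomposition (proj₁ (proj₂ returned))

    returned-correct : IsSwapSequence K s
    returned-correct = record { alongEdges = run-edges run ; reachesTarget = reaches }
      where
      open ≡-Reasoning
      reaches : ∀ t → perform f₁ s ⟨$⟩ʳ t ≡ f₂ ⟨$⟩ʳ t
      reaches t = begin
        perform f₁ s ⟨$⟩ʳ t                    ≡⟨ perform-follow f₁ s t ⟩
        follow s (f₁ ⟨$⟩ʳ t)                   ≡⟨ run-follow run (f₁ ⟨$⟩ʳ t) ⟩
        follow (schedule cs) (f₁ ⟨$⟩ʳ t)       ≡⟨ schedule-follow π cs cycles disjoint (covers _) ⟩
        f₂ ⟨$⟩ʳ (f₁ ⟨$⟩ˡ (f₁ ⟨$⟩ʳ t))          ≡⟨ cong (f₂ ⟨$⟩ʳ_) (inverseˡ f₁) ⟩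
        f₂ ⟨$⟩ʳ t                              ∎

    returned-length : ∀ {s*} → IsSwapSequence K s* → length s ≤ 4 * length s*
    returned-length {s*} s*-correct = begin
      -- `moves s*` can serve as the weight because `s*` itself takes the token on `u` to `π u`.
      length s                                              ≤⟨ run-length (moves s*) (All.map path (schedule-pairs π cycles)) run ⟩
      2 * sum (map (moves s* ∘ proj₁) (schedule cs))        ≤⟨ *-monoʳ-≤ 2 (sum-schedule (moves s*) cs) ⟩
      2 * sum (map (moves s*) (concatMap toList cs))        ≤⟨ *-monoʳ-≤ 2 (sum-moves s* disjoint) ⟩
      2 * (2 * length s*)                                   ≡⟨ *-assoc 2 2 (length s*) ⟨
      4 * length s*                                         ∎
      where
      open ≤-Reasoning
      open IsSwapSequence s*-correct

      -- This is `reachesTarget` read at the token that starts on `u`.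
      follow-π : ∀ u → follow s* u ≡ π ⟨$⟩ʳ u
      follow-π u = trans (cong (follow s*) (sym (inverseʳ f₁)))
        (trans (sym (perform-follow f₁ s* (f₁ ⟨$⟩ˡ u))) (reachesTarget (f₁ ⟨$⟩ˡ u)))

      path : ∀ {ps} → π ⟨$⟩ʳ proj₁ ps ≡ proj₂ ps →
             ∃[ q ] IsPath K (proj₁ ps) (proj₂ ps) q × pathLength q ≤ moves s* (proj₁ ps)
      path {u , v} πu≡v =
        subst (λ y → ∃[ q ] IsPath K u y q × pathLength q ≤ moves s* u)
          (trans (follow-π u) πu≡v) (moves-path alongEdges u)

claimA2 : ∀ {n : ℕ} (K : Instance n) {opt alg : ℕ} →
    IsOPT K opt → IsALG K alg → opt ≤ alg × alg ≤ 4 * opt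
claimA2 K record { attained = s* , s*-correct , refl ; minimal = minimal } (s , returned , refl) =
  -- The output is itself a swap sequence, so minimality gives the lower bound; the upper bound
  -- compares it with the sequence attaining the optimum.
  minimal (returned-correct K returned) , returned-length K returned s*-correct
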